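{- Let $\mathcal{M}$ be a class of D\L L-models, let $\varphi$ be a D\L L-formula, and let $x$ be a string which is a $k$-combination of $\mathbf{D},\mathbf{4},\mathbf{5},\mathbf{T}$, where $k\in\{1,\ldots,4\}$. 1. If $\vdash_{\mathbf{B\text{\L}}}\varphi$, then $\mathcal{M}\vDash\varphi$. 2. If $\vdash_{\mathbf{B\text{\L}}_{\mathbf{D}}}\varphi$ and $\mathcal{M}$ is serial, then $\mathcal{M}\vDash\varphi$. 3. If $\vdash_{\mathbf{B\text{\L}}_{\mathbf{4}}}\varphi$ and $\mathcal{M}$ is transitive, then $\mathcal{M}\vDash\varphi$. 4. If $\vdash_{\mathbf{B\text{\L}}_{\mathbf{5}}}\varphi$ and $\mathcal{M}$ is recognizable, then $\mathcal{M}\vDash\varphi$. 5. If $\vdash_{\mathbf{B\text{\L}}_{\mathbf{T}}}\varphi$ and $\mathcal{M}$ is reflexive, then $\mathcal{M}\vDash\varphi$. 6. If $\vdash_{\mathbf{B\text{\L}}_{x}}\varphi$ and $\mathcal{M}$ has all the properties of accessibility relations corresponding to the axioms of $x$ (serial for $\mathbf{D}$, transitive for $\mathbf{4}$, recognizable for $\mathbf{5}$, reflexive for $\mathbf{T}$), then $\mathcal{M}\vDash\varphi$.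
   Context: Language. Let $\mathcal{P}$ be the set of atomic propositions and $\mathcal{A}$ the set of agents; $\bot$ is a propositional constant. D\L L-formulae are generated by $\varphi ::= p \mid \neg\varphi \mid \varphi\,\&\,\varphi \mid \varphi\to\varphi \mid B_a\varphi$ ($p\in\mathcal{P}$, $a\in\mathcal{A}$), together with the constant $\bot$. One writes $B,r$ for $B_a,r_a$ with $a\in\mathcal{A}$ arbitrary. Models. A D\L L-model is $\mathfrak{M}=(S,(r_a)_{a\in\mathcal{A}},\pi)$ with $S$ a set of states, $r_a:S\times S\to[0,1]$ for each $a\in\mathcal{A}$, and $\pi:S\times\mathcal{P}\to[0,1]$. The valuation $V_s(\varphi)\in[0,1]$ is defined by $V_s(p)=\pi(s,p)$, $V_s(\bot)=0$, $V_s(\neg\varphi)=1-V_s(\varphi)$, $V_s(\varphi\,\&\,\psi)=\max\{0,V_s(\varphi)+V_s(\psi)-1\}$, $V_s(\varphi\to\psi)=\min\{1,1-V_s(\varphi)+V_s(\psi)\}$, $V_s(B_a\varphi)=\inf_{s'\in S}\max\{1-r_a(s,s'),V_{s'}(\varphi)\}$. Validity. $(\mathfrak{M},s)\vDash\varphi$ means $V_s(\varphi)=1$; $\mathfrak{M}\vDash\varphi$ means this holds for all $s\in S$; $\mathcal{M}\vDash\varphi$ means $\mathfrak{M}\vDash\varphi$ for all $\mathfrak{M}\in\mathcal{M}$. Properties of models. $\mathfrak{M}$ is serial if for all $a$ and $s$ there is $s'$ with $r_a(s,s')=1$; reflexive if $r_a(s,s)=1$ for all $a,s$; transitive if $r_a(s,s'')\ge\min\{r_a(s,s'),r_a(s',s'')\}$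 for all $a,s,s',s''$; recognizable if $r_a(s,s')\le 0.5$ for all $a,s,s'$. A class $\mathcal{M}$ has one of these properties if every model in it does. Axioms and rules (for all formulae $\varphi,\psi$ and each agent): (\L$_B$0) all instances of tautologies of propositional \L ukasiewicz logic; (\L$_B$1) $(B\varphi\,\&\,B(\varphi\to\psi))\to B\psi$; (\L$_B$2) $\neg B\bot$; (\L$_B$3) $B\varphi\to BB\varphi$; (\L$_B$4) $\neg B\varphi\to B\neg B\varphi$; (\L$_B$5) $B\varphi\to\varphi$; (R$_{\text{MP}}$) from $\varphi$ and $\varphi\to\psi$ infer $\psi$; (R$_{\text{GB}}$) from $\varphi$ infer $B\varphi$. Systems. $\mathbf{B\text{\L}}$ has axioms (\L$_B$0), (\L$_B$1) and rules (R$_{\text{MP}}$), (R$_{\text{GB}}$). Subscripts $\mathbf{D},\mathbf{4},\mathbf{5},\mathbf{T}$ indicate the addition of (\L$_B$2), (\L$_B$3), (\L$_B$4), (\L$_B$5) respectively; $\mathbf{B\text{\L}}_x$ adds the axioms corresponding to all symbols in $x$. $\vdash_{\mathbf{A}}\varphi$ means there is a finite sequence of formulae ending in $\varphi$, each of which is an axiom of $\mathbf{A}$ or obtained from earlier ones by (R$_{\text{MP}}$) or (R$_{\text{GB}}$). -}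

module Defs where

open import Algebra.Bundles using (CommutativeRing)
open import Data.List.Base using (List; []; _∷_; length)
open import Data.List.Membership.Propositional using (_∈_)
open import Data.List.Relation.Unary.Unique.Propositional using (Unique)
open import Data.Nat.Base using (ℕ)
open import Data.Product.Base using (∃; ∃-syntax; _×_; _,_; proj₁; proj₂)
open import Data.Sum.Base using (inj₁; inj₂)
open import Level using (Level; suc; _⊔_)
open import Relation.Binary.Bundles using (DecTotalOrder)
open import Relation.Binary.Core using (Rel)
open import Relation.Binary.PropositionalEquality.Core using (_≡_)
open import Relation.Binary.Structures using (IsDecTotalOrder)
open import Relation.Nullary.Negation.Core using (¬_)
open import Relation.Unary using (Pred; Satisfiable)

import Algebra.Construct.NaturalChoice.Max as Max
import Algebra.Construct.NaturalChoice.Min as Min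
import Algebra.Properties.Ring as RingProperties

private
  variable
    p a : Level

-- The real numbers, characterised (classically, up to unique isomorphism) as a
-- Dedekind-complete ordered field.  Completeness is stated for infima.  The
-- order is decidable, as it is for the classical reals.

record CompleteOrderedField (ℓ : Level) : Set (suc ℓ) where
  infix 4 _≤_
  field
    commutativeRing : CommutativeRing ℓ ℓ

  open CommutativeRing commutativeRing public

  field
    _≤_             : Rel Carrier ℓ
    isDecTotalOrder : IsDecTotalOrder _≈_ _≤_
    0≉1             : ¬ (0# ≈ 1#)
    inverse         : ∀ x → ¬ (x ≈ 0#) → ∃[ y ] x * y ≈ 1#
    +-monoˡ-≤       : ∀ z {x y} → x ≤ y → x + z ≤ y + z
    *-nonNegative   : ∀ {x y} → 0# ≤ x → 0# ≤ y → 0# ≤ x * y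

  LowerBound : Pred Carrier ℓ → Pred Carrier ℓ
  LowerBound P b = ∀ x → P x → b ≤ x

  IsInfimum : Pred Carrier ℓ → Pred Carrier ℓ
  IsInfimum P m = LowerBound P m × (∀ b → LowerBound P b → b ≤ m)

  field
    complete : ∀ (P : Pred Carrier ℓ) → Satisfiable P → ∃ (LowerBound P) →
               ∃ (IsInfimum P)

  decTotalOrder : DecTotalOrder ℓ ℓ ℓ
  decTotalOrder = record { isDecTotalOrder = isDecTotalOrder }

  open DecTotalOrder decTotalOrder public
    using (totalOrder; poset; total; antisym; _≤?_; ≤-respˡ-≈; ≤-respʳ-≈)
    renaming (refl to ≤-refl; reflexive to ≤-reflexive; trans to ≤-trans)

  open Max totalOrder public using () renaming (_⊔_ to max)
  open Min totalOrder public using () renaming (_⊓_ to min)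

module _ {ℓ} (ℝ : CompleteOrderedField ℓ) where
  open CompleteOrderedField ℝ
  open RingProperties ring using (-‿distribˡ-*; -‿involutive)
  private
    module ⊔ = Max totalOrder
    module ⊓ = Min totalOrder

  x≤y⇒0≤y-x : ∀ {x y} → x ≤ y → 0# ≤ y - x
  x≤y⇒0≤y-x {x} x≤y = ≤-respˡ-≈ (-‿inverseʳ x) (+-monoˡ-≤ (- x) x≤y)

  0≤y⇒x-y≤x : ∀ {x y} → 0# ≤ y → x - y ≤ x
  0≤y⇒x-y≤x {x} {y} 0≤y =
    ≤-respʳ-≈ (trans (+-comm y (x - y))
                (trans (+-assoc x (- y) y)
                  (trans (+-congˡ (-‿inverseˡ y)) (+-identityʳ x))))
      (≤-respˡ-≈ (+-identityˡ (x - y)) (+-monoˡ-≤ (x - y) 0≤y))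

  +-nonNegative : ∀ {x y} → 0# ≤ x → 0# ≤ y → 0# ≤ x + y
  +-nonNegative {x} {y} 0≤x 0≤y =
    ≤-trans 0≤y (≤-respˡ-≈ (+-identityˡ y) (+-monoˡ-≤ y 0≤x))

  0≤1 : 0# ≤ 1#
  0≤1 with total 0# 1#
  ... | inj₁ 0≤1 = 0≤1
  ... | inj₂ 1≤0 = ≤-respʳ-≈ [-1]²≈1 (*-nonNegative 0≤-1 0≤-1)
    where
    0≤-1 : 0# ≤ - 1#
    0≤-1 = ≤-respʳ-≈ (+-identityˡ (- 1#)) (x≤y⇒0≤y-x 1≤0)

    [-1]²≈1 : - 1# * - 1# ≈ 1#
    [-1]²≈1 = trans (sym (-‿distribˡ-* 1# (- 1#)))
                (trans (-‿cong (*-identityˡ (- 1#))) (-‿involutive 1#))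

  2≉0 : ¬ (1# + 1# ≈ 0#)
  2≉0 2≈0 = 0≉1 (antisym 0≤1 (≤-respʳ-≈ 2≈0
    (≤-respˡ-≈ (+-identityˡ 1#) (+-monoˡ-≤ 1# 0≤1))))

  ½ : Carrier
  ½ = proj₁ (inverse (1# + 1#) 2≉0)

  record UnitInterval : Set ℓ where
    constructor mkUnit
    field
      value   : Carrier
      0≤value : 0# ≤ value
      value≤1 : value ≤ 1#

  open UnitInterval

  0ᵁ : UnitInterval
  0ᵁ = mkUnit 0# ≤-refl 0≤1

  negᵁ : UnitInterval → UnitInterval
  negᵁ x .value   = 1# - value x
  negᵁ x .0≤value = x≤y⇒0≤y-x (value≤1 x)
  negᵁ x .value≤1 = 0≤y⇒x-y≤x (0≤value x)

  andᵁ : UnitInterval → UnitInterval → UnitInterval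
  andᵁ x y .value   = max 0# ((value x + value y) - 1#)
  andᵁ x y .0≤value = ⊔.x≤x⊔y 0# _
  andᵁ x y .value≤1 = ⊔.⊔-lub 0≤1
    (≤-trans
      (≤-respʳ-≈ (trans (+-assoc 1# (value y) (- 1#)) (+-comm 1# (value y - 1#)))
        (+-monoˡ-≤ (- 1#) (+-monoˡ-≤ (value y) (value≤1 x))))
      (≤-trans
        (+-monoˡ-≤ 1# (+-monoˡ-≤ (- 1#) (value≤1 y)))
        (≤-reflexive (trans (+-congʳ (-‿inverseʳ 1#)) (+-identityˡ 1#)))))

  impᵁ : UnitInterval → UnitInterval → UnitInterval
  impᵁ x y .value   = min 1# ((1# - value x) + value y)
  impᵁ x y .0≤value =
    ⊓.⊓-glb 0≤1 (+-nonNegative (x≤y⇒0≤y-x (value≤1 x)) (0≤value y))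
  impᵁ x y .value≤1 = ⊓.x⊓y≤x 1# _

  maxᵁ : UnitInterval → UnitInterval → UnitInterval
  maxᵁ x y .value   = max (value x) (value y)
  maxᵁ x y .0≤value = ≤-trans (0≤value x) (⊔.x≤x⊔y (value x) (value y))
  maxᵁ x y .value≤1 = ⊔.⊔-lub (value≤1 x) (value≤1 y)

  Range : {I : Set ℓ} → (I → UnitInterval) → Pred Carrier ℓ
  Range f x = ∃[ i ] x ≈ value (f i)

  Range-infimum : {I : Set ℓ} → I → (f : I → UnitInterval) →
                  ∃ (IsInfimum (Range f))
  Range-infimum i f = complete (Range f) (value (f i) , i , refl)
    (0# , λ { x (j , x≈fj) → ≤-respʳ-≈ (sym x≈fj) (0≤value (f j)) })

  -- The first argument witnesses that the index set is nonempty.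
  infᵁ : {I : Set ℓ} → I → (I → UnitInterval) → UnitInterval
  infᵁ i f .value   = proj₁ (Range-infimum i f)
  infᵁ i f .0≤value = proj₂ (proj₂ (Range-infimum i f)) 0#
    λ { x (j , x≈fj) → ≤-respʳ-≈ (sym x≈fj) (0≤value (f j)) }
  infᵁ i f .value≤1 =
    ≤-trans (proj₁ (proj₂ (Range-infimum i f)) (value (f i)) (i , refl))
            (value≤1 (f i))

infix  9 ¬ᶠ_ ¬ᵖ_
infixr 7 _&_ _&ᵖ_
infixr 5 _⇒_ _⇒ᵖ_

data Formula (𝒫 : Set p) (𝒜 : Set a) : Set (p ⊔ a) where
  atom : 𝒫 → Formula 𝒫 𝒜
  ⊥ᶠ   : Formula 𝒫 𝒜
  ¬ᶠ_  : Formula 𝒫 𝒜 → Formula 𝒫 𝒜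
  _&_  : Formula 𝒫 𝒜 → Formula 𝒫 𝒜 → Formula 𝒫 𝒜
  _⇒_  : Formula 𝒫 𝒜 → Formula 𝒫 𝒜 → Formula 𝒫 𝒜
  B    : 𝒜 → Formula 𝒫 𝒜 → Formula 𝒫 𝒜

-- Propositional Łukasiewicz logic has countably many variables of its own, so
-- that its tautologies do not depend on how many atomic propositions 𝒫 has.
data PropFormula : Set where
  var  : ℕ → PropFormula
  ⊥ᵖ   : PropFormula
  ¬ᵖ_  : PropFormula → PropFormula
  _&ᵖ_ : PropFormula → PropFormula → PropFormula
  _⇒ᵖ_ : PropFormula → PropFormula → PropFormula

_[_] : {𝒫 : Set p} {𝒜 : Set a} → PropFormula → (ℕ → Formula 𝒫 𝒜) → Formula 𝒫 𝒜
var n    [ σ ] = σ n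
⊥ᵖ       [ σ ] = ⊥ᶠ
(¬ᵖ α)   [ σ ] = ¬ᶠ (α [ σ ])
(α &ᵖ β) [ σ ] = (α [ σ ]) & (β [ σ ])
(α ⇒ᵖ β) [ σ ] = (α [ σ ]) ⇒ (β [ σ ])

data AxiomSymbol : Set where
  𝐃 𝟒 𝟓 𝐓 : AxiomSymbol

IsCombination : ℕ → List AxiomSymbol → Set
IsCombination k x = Unique x × length x ≡ k

module DŁL {ℓ p a} (ℝ : CompleteOrderedField ℓ) (𝒫 : Set p) (𝒜 : Set a) where
  open CompleteOrderedField ℝ using (_≈_; _≤_; 1#; min)
  open UnitInterval using (value)

  private
    [0,1] : Set ℓ
    [0,1] = UnitInterval ℝ

    Fm : Set (p ⊔ a)
    Fm = Formula 𝒫 𝒜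

  record Model : Set (suc ℓ ⊔ p ⊔ a) where
    field
      S : Set ℓ
      r : 𝒜 → S → S → [0,1]
      π : S → 𝒫 → [0,1]

  V : (𝔐 : Model) → Model.S 𝔐 → Fm → [0,1]
  V 𝔐 s (atom q) = Model.π 𝔐 s q
  V 𝔐 s ⊥ᶠ       = 0ᵁ ℝ
  V 𝔐 s (¬ᶠ φ)   = negᵁ ℝ (V 𝔐 s φ)
  V 𝔐 s (φ & ψ)  = andᵁ ℝ (V 𝔐 s φ) (V 𝔐 s ψ)
  V 𝔐 s (φ ⇒ ψ)  = impᵁ ℝ (V 𝔐 s φ) (V 𝔐 s ψ)
  V 𝔐 s (B b φ)  =
    infᵁ ℝ s (λ s′ → maxᵁ ℝ (negᵁ ℝ (Model.r 𝔐 b s s′)) (V 𝔐 s′ φ))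

  Holds : (𝔐 : Model) → Model.S 𝔐 → Fm → Set ℓ
  Holds 𝔐 s φ = value (V 𝔐 s φ) ≈ 1#

  ModelValid : Model → Fm → Set ℓ
  ModelValid 𝔐 φ = ∀ s → Holds 𝔐 s φ

  infix 3 _⊨_
  _⊨_ : ∀ {m} → Pred Model m → Fm → Set (suc ℓ ⊔ p ⊔ a ⊔ m)
  𝓜 ⊨ φ = ∀ 𝔐 → 𝓜 𝔐 → ModelValid 𝔐 φ

  Serial : Pred Model (ℓ ⊔ a)
  Serial 𝔐 = ∀ b s → ∃[ s′ ] value (r b s s′) ≈ 1#
    where open Model 𝔐

  Reflexive : Pred Model (ℓ ⊔ a)
  Reflexive 𝔐 = ∀ b s → value (r b s s) ≈ 1#
    where open Model 𝔐

  Transitive : Pred Model (ℓ ⊔ a)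
  Transitive 𝔐 = ∀ b s s′ s″ →
    min (value (r b s s′)) (value (r b s′ s″)) ≤ value (r b s s″)
    where open Model 𝔐

  Recognizable : Pred Model (ℓ ⊔ a)
  Recognizable 𝔐 = ∀ b s s′ → value (r b s s′) ≤ ½ ℝ
    where open Model 𝔐

  Property : AxiomSymbol → Pred Model (ℓ ⊔ a)
  Property 𝐃 = Serial
  Property 𝟒 = Transitive
  Property 𝟓 = Recognizable
  Property 𝐓 = Reflexive

  eval : PropFormula → (ℕ → [0,1]) → [0,1]
  eval (var n)  v = v n
  eval ⊥ᵖ       v = 0ᵁ ℝ
  eval (¬ᵖ α)   v = negᵁ ℝ (eval α v)
  eval (α &ᵖ β) v = andᵁ ℝ (eval α v) (eval β v)
  eval (α ⇒ᵖ β) v = impᵁ ℝ (eval α v) (eval β v)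

  Tautology : Pred PropFormula ℓ
  Tautology α = ∀ v → value (eval α v) ≈ 1#

  -- The axioms of the system BŁₓ, where x lists the additional axioms.
  data Axiom (x : List AxiomSymbol) : Pred Fm (ℓ ⊔ p ⊔ a) where
    Ł0 : ∀ α → Tautology α → (σ : ℕ → Fm) → Axiom x (α [ σ ])
    Ł1 : ∀ b φ ψ → Axiom x ((B b φ & B b (φ ⇒ ψ)) ⇒ B b ψ)
    Ł2 : 𝐃 ∈ x → ∀ b → Axiom x (¬ᶠ B b ⊥ᶠ)
    Ł3 : 𝟒 ∈ x → ∀ b φ → Axiom x (B b φ ⇒ B b (B b φ))
    Ł4 : 𝟓 ∈ x → ∀ b φ → Axiom x (¬ᶠ B b φ ⇒ B b (¬ᶠ B b φ))
    Ł5 : 𝐓 ∈ x → ∀ b φ → Axiom x (B b φ ⇒ φ)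

  data Justified (x : List AxiomSymbol) (Γ : List Fm) : Pred Fm (ℓ ⊔ p ⊔ a) where
    axiom : ∀ {φ} → Axiom x φ → Justified x Γ φ
    R-MP  : ∀ {φ ψ} → φ ∈ Γ → (φ ⇒ ψ) ∈ Γ → Justified x Γ ψ
    R-GB  : ∀ {φ} b → φ ∈ Γ → Justified x Γ (B b φ)

  -- Formal proofs are finite sequences of formulae, listed with the last
  -- formula at the head.
  data IsProof (x : List AxiomSymbol) : Pred (List Fm) (ℓ ⊔ p ⊔ a) where
    []  : IsProof x []
    _∷_ : ∀ {φ Γ} → Justified x Γ φ → IsProof x Γ → IsProof x (φ ∷ Γ)

  infix 3 BŁ⟨_⟩⊢_
  BŁ⟨_⟩⊢_ : List AxiomSymbol → Fm → Set (ℓ ⊔ p ⊔ a)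
  BŁ⟨ x ⟩⊢ φ = ∃[ Γ ] IsProof x (φ ∷ Γ)

{-# OPTIONS --safe #-}
module Submission where

open import Defs
open import Data.List.Base using (List; []; _∷_)
open import Data.List.Membership.Propositional using (_∈_)
open import Data.List.Relation.Unary.All as All using (All; []; _∷_)
open import Data.List.Relation.Unary.Any using (here)
open import Data.Nat.Base using (ℕ)
open import Data.Product.Base using (_×_; _,_; proj₁; proj₂)
open import Data.Sum.Base as Sum using (_⊎_; inj₁; inj₂)
open import Relation.Binary.PropositionalEquality.Core as ≡ using (_≡_)
open import Relation.Nullary.Decidable.Core using (yes; no)
open import Relation.Nullary.Negation.Core using (contradiction)
open import Relation.Unary using (Pred; _⊆_)

import Algebra.Construct.NaturalChoice.Max as Max
import Algebra.Construct.NaturalChoice.Min as Min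
import Algebra.Properties.AbelianGroup as AbelianGroupProperties
import Relation.Binary.Reasoning.PartialOrder as PosetReasoning

-- Each axiom reduces to a pointwise inequality between truth values, because
-- φ → ψ has value 1 exactly when the value of φ is at most that of ψ, and the
-- value of B φ is the greatest lower bound of max (1 - r) φ.  For Ł4 the bound
-- r ≤ ½ forces ½ ≤ B φ at every state, so ¬ B φ ≤ ½ ≤ 1 - r.

module _ {ℓ} (ℝ : CompleteOrderedField ℓ) where
  open CompleteOrderedField ℝ
  open UnitInterval
  open AbelianGroupProperties +-abelianGroup using (xyx⁻¹≈y)
  open PosetReasoning poset
  private
    module ⊔ = Max totalOrder
    module ⊓ = Min totalOrder

  -- Ordered-field arithmetic.

  x+[y-x]≈y : ∀ x y → x + (y - x) ≈ y
  x+[y-x]≈y x y = trans (sym (+-assoc x y (- x))) (xyx⁻¹≈y x y)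

  +-monoʳ-≤ : ∀ z {x y} → x ≤ y → z + x ≤ z + y
  +-monoʳ-≤ z {x} {y} x≤y = begin
    z + x  ≈⟨ +-comm z x ⟩
    x + z  ≤⟨ +-monoˡ-≤ z x≤y ⟩
    y + z  ≈⟨ +-comm y z ⟩
    z + y  ∎

  +-mono-≤ : ∀ {x y u v} → x ≤ y → u ≤ v → x + u ≤ y + v
  +-mono-≤ {y = y} {u} x≤y u≤v = ≤-trans (+-monoˡ-≤ u x≤y) (+-monoʳ-≤ y u≤v)

  +-cancelˡ-≤ : ∀ z {x y} → z + x ≤ z + y → x ≤ y
  +-cancelˡ-≤ z {x} {y} z+x≤z+y = begin
    x            ≈⟨ xyx⁻¹≈y z x ⟨
    (z + x) - z  ≤⟨ +-monoˡ-≤ (- z) z+x≤z+y ⟩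
    (z + y) - z  ≈⟨ xyx⁻¹≈y z y ⟩
    y            ∎

  x≤y+z⇒x-y≤z : ∀ {x y z} → x ≤ y + z → x - y ≤ z
  x≤y+z⇒x-y≤z {x} {y} {z} x≤y+z =
    +-cancelˡ-≤ y (≤-respˡ-≈ (sym (x+[y-x]≈y y x)) x≤y+z)

  y+z≤x⇒z≤x-y : ∀ {x y z} → y + z ≤ x → z ≤ x - y
  y+z≤x⇒z≤x-y {x} {y} {z} y+z≤x =
    +-cancelˡ-≤ y (≤-respʳ-≈ (sym (x+[y-x]≈y y x)) y+z≤x)

  -‿antiʳ-≤ : ∀ z {x y} → x ≤ y → z - y ≤ z - x
  -‿antiʳ-≤ z {x} {y} x≤y = x≤y+z⇒x-y≤z (begin
    z            ≈⟨ x+[y-x]≈y x z ⟨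
    x + (z - x)  ≤⟨ +-monoˡ-≤ (z - x) x≤y ⟩
    y + (z - x)  ∎)

  -- Makes `½` the fixed point of negation, so that negation exchanges the two halves of the unit
  -- interval.
  ½+½≈1 : ½ ℝ + ½ ℝ ≈ 1#
  ½+½≈1 = begin-equality
    ½ ℝ + ½ ℝ            ≈⟨ +-cong (*-identityˡ (½ ℝ)) (*-identityˡ (½ ℝ)) ⟨
    1# * ½ ℝ + 1# * ½ ℝ  ≈⟨ distribʳ (½ ℝ) 1# 1# ⟨
    (1# + 1#) * ½ ℝ      ≈⟨ proj₂ (inverse (1# + 1#) (2≉0 ℝ)) ⟩
    1#                   ∎

  x≤½⇒½≤1-x : ∀ {x} → x ≤ ½ ℝ → ½ ℝ ≤ 1# - x
  x≤½⇒½≤1-x x≤½ = y+z≤x⇒z≤x-y (≤-respʳ-≈ ½+½≈1 (+-monoˡ-≤ (½ ℝ) x≤½))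

  ½≤x⇒1-x≤½ : ∀ {x} → ½ ℝ ≤ x → 1# - x ≤ ½ ℝ
  ½≤x⇒1-x≤½ ½≤x = x≤y+z⇒x-y≤z (≤-respˡ-≈ ½+½≈1 (+-monoˡ-≤ (½ ℝ) ½≤x))

  x≤y⊔z⇒x≤y⊎x≤z : ∀ {x} y z → x ≤ max y z → x ≤ y ⊎ x ≤ z
  x≤y⊔z⇒x≤y⊎x≤z y z x≤y⊔z =
    Sum.map (λ eq → ≤-respʳ-≈ eq x≤y⊔z) (λ eq → ≤-respʳ-≈ eq x≤y⊔z)
            (⊔.⊔-sel y z)

  -- Turns transitivity of r into an ultrametric inequality for the distance 1 - r.
  min≤⇒1-≤max : ∀ {x y z} → min x y ≤ z → 1# - z ≤ max (1# - x) (1# - y)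
  min≤⇒1-≤max {x} {y} x⊓y≤z with ⊓.⊓-sel x y
  ... | inj₁ eq = ⊔.x≤y⇒x≤y⊔z _ (-‿antiʳ-≤ 1# (≤-respˡ-≈ eq x⊓y≤z))
  ... | inj₂ eq = ⊔.x≤y⇒x≤z⊔y _ (-‿antiʳ-≤ 1# (≤-respˡ-≈ eq x⊓y≤z))

  -- Łukasiewicz connectives and infima on the unit interval.

  impᵁ≈1⁺ : ∀ x y → value x ≤ value y → value (impᵁ ℝ x y) ≈ 1#
  impᵁ≈1⁺ x y x≤y = antisym (⊓.x⊓y≤x 1# _) (⊓.⊓-glb ≤-refl (begin
    1#                          ≈⟨ x+[y-x]≈y (value x) 1# ⟨
    value x + (1# - value x)    ≈⟨ +-comm _ _ ⟩
    (1# - value x) + value x    ≤⟨ +-monoʳ-≤ (1# - value x) x≤y ⟩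
    (1# - value x) + value y    ∎))

  -- One half of residuation, in additive form: it avoids the truncation at 0 in the strong
  -- conjunction and matches the premise of `andᵁ-lub`.
  ≤impᵁ⁻ : ∀ x y {z} → z ≤ value (impᵁ ℝ x y) → value x + z ≤ 1# + value y
  ≤impᵁ⁻ x y {z} z≤x⇒y = begin
    value x + z                            ≤⟨ +-monoʳ-≤ (value x) (⊓.x≤y⊓z⇒x≤z 1# _ z≤x⇒y) ⟩
    value x + ((1# - value x) + value y)   ≈⟨ +-assoc _ _ _ ⟨
    (value x + (1# - value x)) + value y   ≈⟨ +-congʳ (x+[y-x]≈y (value x) 1#) ⟩
    1# + value y                           ∎

  impᵁ≈1⁻ : ∀ x y → value (impᵁ ℝ x y) ≈ 1# → value x ≤ value y
  impᵁ≈1⁻ x y x⇒y≈1 = +-cancelˡ-≤ 1# (begin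
    1# + value x  ≈⟨ +-comm _ _ ⟩
    value x + 1#  ≤⟨ ≤impᵁ⁻ x y (≤-reflexive (sym x⇒y≈1)) ⟩
    1# + value y  ∎)

  -- Truncation at 0 costs nothing, because the bound is itself a truth value.
  andᵁ-lub : (x y z : UnitInterval ℝ) → value x + value y ≤ 1# + value z →
             value (andᵁ ℝ x y) ≤ value z
  andᵁ-lub x y z x+y≤1+z = ⊔.⊔-lub (0≤value z) (x≤y+z⇒x-y≤z x+y≤1+z)

  infᵁ-lower : {I : Set ℓ} (i : I) (f : I → UnitInterval ℝ) →
               ∀ j → value (infᵁ ℝ i f) ≤ value (f j)
  infᵁ-lower i f j = proj₁ (proj₂ (Range-infimum ℝ i f)) (value (f j)) (j , refl)

  infᵁ-greatest : {I : Set ℓ} (i : I) (f : I → UnitInterval ℝ) →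
                  ∀ {b} → (∀ j → b ≤ value (f j)) → b ≤ value (infᵁ ℝ i f)
  infᵁ-greatest i f {b} b≤f = proj₂ (proj₂ (Range-infimum ℝ i f)) b
    λ { x (j , x≈fj) → ≤-respʳ-≈ (sym x≈fj) (b≤f j) }

  module _ {p a} (𝒫 : Set p) (𝒜 : Set a) where
    open DŁL ℝ 𝒫 𝒜

    -- `V` and `eval` interpret the connectives by the same operations, so congruence suffices;
    -- substituted formulas, modal or not, enter only through their truth values.
    V-[] : ∀ 𝔐 s α (σ : ℕ → Formula 𝒫 𝒜) →
           V 𝔐 s (α [ σ ]) ≡ eval α (λ n → V 𝔐 s (σ n))
    V-[] 𝔐 s (var n)  σ = ≡.refl
    V-[] 𝔐 s ⊥ᵖ       σ = ≡.refl
    V-[] 𝔐 s (¬ᵖ α)   σ = ≡.cong (negᵁ ℝ) (V-[] 𝔐 s α σ)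
    V-[] 𝔐 s (α &ᵖ β) σ = ≡.cong₂ (andᵁ ℝ) (V-[] 𝔐 s α σ) (V-[] 𝔐 s β σ)
    V-[] 𝔐 s (α ⇒ᵖ β) σ = ≡.cong₂ (impᵁ ℝ) (V-[] 𝔐 s α σ) (V-[] 𝔐 s β σ)

    -- Bounds for belief in a fixed model.

    module _ (𝔐 : Model) where
      open Model 𝔐

      ⟦_⟧ : Formula 𝒫 𝒜 → S → Carrier
      ⟦ φ ⟧ s = value (V 𝔐 s φ)

      r̄ : 𝒜 → S → S → Carrier
      r̄ b s s′ = 1# - value (r b s s′)

      accessTerm : 𝒜 → Formula 𝒫 𝒜 → S → S → UnitInterval ℝ
      accessTerm b φ s s′ = maxᵁ ℝ (negᵁ ℝ (r b s s′)) (V 𝔐 s′ φ)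

      B-lower : ∀ b φ s s′ → ⟦ B b φ ⟧ s ≤ max (r̄ b s s′) (⟦ φ ⟧ s′)
      B-lower b φ s = infᵁ-lower s (accessTerm b φ s)

      B-greatest : ∀ b φ s {x} → (∀ s′ → x ≤ max (r̄ b s s′) (⟦ φ ⟧ s′)) →
                   x ≤ ⟦ B b φ ⟧ s
      B-greatest b φ s = infᵁ-greatest s (accessTerm b φ s)

      B-lower-⊎ : ∀ b φ s s′ → ⟦ B b φ ⟧ s ≤ r̄ b s s′ ⊎ ⟦ B b φ ⟧ s ≤ ⟦ φ ⟧ s′
      B-lower-⊎ b φ s s′ = x≤y⊔z⇒x≤y⊎x≤z _ _ (B-lower b φ s s′)

      -- At a fully accessible state 1 - r vanishes and the maximum collapses to the value of φ.
      -- Seriality and reflexivity both supply such a state.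
      B-lower-r≈1 : ∀ b φ s s′ → value (r b s s′) ≈ 1# → ⟦ B b φ ⟧ s ≤ ⟦ φ ⟧ s′
      B-lower-r≈1 b φ s s′ r≈1 = ≤-trans (B-lower b φ s s′) (⊔.⊔-lub (begin
        1# - value (r b s s′)  ≈⟨ +-congˡ (-‿cong r≈1) ⟩
        1# - 1#                ≈⟨ -‿inverseʳ 1# ⟩
        0#                     ≤⟨ 0≤value (V 𝔐 s′ φ) ⟩
        ⟦ φ ⟧ s′               ∎) ≤-refl)

      -- Soundness of the modal axioms and the rules.

      Ł1-sound : ∀ b φ ψ → ModelValid 𝔐 ((B b φ & B b (φ ⇒ ψ)) ⇒ B b ψ)
      Ł1-sound b φ ψ s =
        impᵁ≈1⁺ (V 𝔐 s (B b φ & B b (φ ⇒ ψ))) (V 𝔐 s (B b ψ))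
          (B-greatest b ψ s λ s′ → andᵁ-lub (V 𝔐 s (B b φ)) (V 𝔐 s (B b (φ ⇒ ψ)))
            (accessTerm b ψ s s′) (bound s′))
        where
        x = ⟦ B b φ ⟧ s
        y = ⟦ B b (φ ⇒ ψ) ⟧ s

        bound : ∀ s′ → x + y ≤ 1# + max (r̄ b s s′) (⟦ ψ ⟧ s′)
        bound s′ with B-lower-⊎ b φ s s′ | B-lower-⊎ b (φ ⇒ ψ) s s′
        -- If either conjunct lies below 1 - r, the trivial bound 1 on the other one is enough.
        ... | inj₁ x≤r̄ | _ = ≤-respˡ-≈ (+-comm y x)
          (+-mono-≤ (value≤1 (V 𝔐 s (B b (φ ⇒ ψ)))) (⊔.x≤y⇒x≤y⊔z _ x≤r̄))
        ... | inj₂ _ | inj₁ y≤r̄ =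
          +-mono-≤ (value≤1 (V 𝔐 s (B b φ))) (⊔.x≤y⇒x≤y⊔z _ y≤r̄)
        -- Otherwise both conjuncts are bounded by values at s′, where many-valued modus ponens
        -- applies.
        ... | inj₂ x≤φ | inj₂ y≤φ⇒ψ = begin
          x + y                               ≤⟨ +-monoˡ-≤ y x≤φ ⟩
          ⟦ φ ⟧ s′ + y                        ≤⟨ ≤impᵁ⁻ (V 𝔐 s′ φ) (V 𝔐 s′ ψ) y≤φ⇒ψ ⟩
          1# + ⟦ ψ ⟧ s′                       ≤⟨ +-monoʳ-≤ 1# (⊔.x≤y⊔x _ _) ⟩
          1# + max (r̄ b s s′) (⟦ ψ ⟧ s′)      ∎

      Ł2-sound : Serial 𝔐 → ∀ b → ModelValid 𝔐 (¬ᶠ B b ⊥ᶠ)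
      Ł2-sound serial b s with s′ , r≈1 ← serial b s =
        antisym (value≤1 (V 𝔐 s (¬ᶠ B b ⊥ᶠ))) (y+z≤x⇒z≤x-y (begin
          ⟦ B b ⊥ᶠ ⟧ s + 1#  ≤⟨ +-monoˡ-≤ 1# (B-lower-r≈1 b ⊥ᶠ s s′ r≈1) ⟩
          0# + 1#            ≈⟨ +-identityˡ 1# ⟩
          1#                 ∎))

      Ł3-sound : Transitive 𝔐 → ∀ b φ → ModelValid 𝔐 (B b φ ⇒ B b (B b φ))
      Ł3-sound transitive b φ s =
        impᵁ≈1⁺ (V 𝔐 s (B b φ)) (V 𝔐 s (B b (B b φ)))
          (B-greatest b (B b φ) s bound)
        where
        x = ⟦ B b φ ⟧ s

        bound : ∀ s′ → x ≤ max (r̄ b s s′) (⟦ B b φ ⟧ s′)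
        -- In the negative case, s′ is accessible enough that a state s″ too far from s to constrain
        -- `x` must, by the ultrametric inequality, be equally far from s′.
        bound s′ with x ≤? r̄ b s s′
        ... | yes x≤r̄ = ⊔.x≤y⇒x≤y⊔z _ x≤r̄
        ... | no  x≰r̄ = ⊔.x≤y⇒x≤z⊔y _ (B-greatest b φ s′ step)
          where
          step : ∀ s″ → x ≤ max (r̄ b s′ s″) (⟦ φ ⟧ s″)
          step s″ with B-lower-⊎ b φ s s″
          ... | inj₂ x≤φ = ⊔.x≤y⇒x≤z⊔y _ x≤φ
          ... | inj₁ x≤r̄ with x≤y⊔z⇒x≤y⊎x≤z _ _
                  (≤-trans x≤r̄ (min≤⇒1-≤max (transitive b s s′ s″)))
          ...   | inj₁ x≤r̄′ = contradiction x≤r̄′ x≰r̄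
          ...   | inj₂ x≤r̄′ = ⊔.x≤y⇒x≤y⊔z _ x≤r̄′

      Ł4-sound : Recognizable 𝔐 → ∀ b φ → ModelValid 𝔐 (¬ᶠ B b φ ⇒ B b (¬ᶠ B b φ))
      Ł4-sound recognizable b φ s =
        impᵁ≈1⁺ (V 𝔐 s (¬ᶠ B b φ)) (V 𝔐 s (B b (¬ᶠ B b φ)))
          (≤-trans (½≤x⇒1-x≤½ (½≤B φ)) (½≤B (¬ᶠ B b φ)))
        where
        ½≤B : ∀ ψ → ½ ℝ ≤ ⟦ B b ψ ⟧ s
        -- The bound comes from 1 - r alone, so it is uniform in ψ and serves both φ and ¬ B φ.
        ½≤B ψ = B-greatest b ψ s λ s′ →
          ⊔.x≤y⇒x≤y⊔z _ (x≤½⇒½≤1-x (recognizable b s s′))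

      Ł5-sound : Reflexive 𝔐 → ∀ b φ → ModelValid 𝔐 (B b φ ⇒ φ)
      Ł5-sound reflexive b φ s =
        impᵁ≈1⁺ (V 𝔐 s (B b φ)) (V 𝔐 s φ) (B-lower-r≈1 b φ s s (reflexive b s))

      MP-sound : ∀ φ ψ → ModelValid 𝔐 φ → ModelValid 𝔐 (φ ⇒ ψ) → ModelValid 𝔐 ψ
      MP-sound φ ψ ⊨φ ⊨φ⇒ψ s = antisym (value≤1 (V 𝔐 s ψ))
        (≤-respˡ-≈ (⊨φ s) (impᵁ≈1⁻ (V 𝔐 s φ) (V 𝔐 s ψ) (⊨φ⇒ψ s)))

      -- Belief at s looks at all states, so the rule is treated as preserving validity in the whole
      -- model rather than truth at a state.
      GB-sound : ∀ b φ → ModelValid 𝔐 φ → ModelValid 𝔐 (B b φ)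
      GB-sound b φ ⊨φ s = antisym (value≤1 (V 𝔐 s (B b φ)))
        (B-greatest b φ s λ s′ → ⊔.x≤y⇒x≤z⊔y _ (≤-reflexive (sym (⊨φ s′))))

      -- Soundness of derivations.

      module _ {x : List AxiomSymbol} (properties : ∀ y → y ∈ x → Property y 𝔐) where

        axiom-sound : ∀ {φ} → Axiom x φ → ModelValid 𝔐 φ
        -- After the rewrite the goal is `α` evaluated at the values of the substituted formulas,
        -- one of the valuations covered by `taut`.
        axiom-sound (Ł0 α taut σ) s rewrite V-[] 𝔐 s α σ = taut _
        axiom-sound (Ł1 b φ ψ)   = Ł1-sound b φ ψ
        axiom-sound (Ł2 𝐃∈x b)   = Ł2-sound (properties 𝐃 𝐃∈x) b
        axiom-sound (Ł3 𝟒∈x b φ) = Ł3-sound (properties 𝟒 𝟒∈x) b φ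
        axiom-sound (Ł4 𝟓∈x b φ) = Ł4-sound (properties 𝟓 𝟓∈x) b φ
        axiom-sound (Ł5 𝐓∈x b φ) = Ł5-sound (properties 𝐓 𝐓∈x) b φ

        justified-sound : ∀ {Γ φ} → All (ModelValid 𝔐) Γ → Justified x Γ φ →
                          ModelValid 𝔐 φ
        justified-sound ⊨Γ (axiom ax) = axiom-sound ax
        justified-sound ⊨Γ (R-MP {φ} {ψ} φ∈Γ φ⇒ψ∈Γ) =
          MP-sound φ ψ (All.lookup ⊨Γ φ∈Γ) (All.lookup ⊨Γ φ⇒ψ∈Γ)
        justified-sound ⊨Γ (R-GB {φ} b φ∈Γ) = GB-sound b φ (All.lookup ⊨Γ φ∈Γ)

        -- The rules cite arbitrary earlier lines, so the induction carries validity of every line,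
        -- not just the last.
        proof-sound : ∀ {Γ} → IsProof x Γ → All (ModelValid 𝔐) Γ
        proof-sound []      = []
        proof-sound (j ∷ π) = justified-sound (proof-sound π) j ∷ proof-sound π

    soundness : ∀ {m} {𝓜 : Pred Model m} {x φ} →
                (∀ y → y ∈ x → 𝓜 ⊆ Property y) → BŁ⟨ x ⟩⊢ φ → 𝓜 ⊨ φ
    soundness 𝓜⊆ (_ , proof) 𝔐 𝔐∈𝓜 =
      All.head (proof-sound 𝔐 (λ y y∈x → 𝓜⊆ y y∈x 𝔐∈𝓜) proof)

    soundness₁ : ∀ {m} {𝓜 : Pred Model m} {φ} y →
                 BŁ⟨ y ∷ [] ⟩⊢ φ → 𝓜 ⊆ Property y → 𝓜 ⊨ φ
    soundness₁ _ ⊢φ 𝓜⊆ = soundness (λ { _ (here ≡.refl) → 𝓜⊆ }) ⊢φ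

open import Data.Nat.Base using (_≤_)

theorem3p1 : ∀ {ℓ p a m} (ℝ : CompleteOrderedField ℓ) (𝒫 : Set p) (𝒜 : Set a) →
    let open DŁL ℝ 𝒫 𝒜 in
    (𝓜 : Pred Model m) (φ : Formula 𝒫 𝒜)
    (k : ℕ) → 1 ≤ k → k ≤ 4 →
    (x : List AxiomSymbol) → IsCombination k x →
    (BŁ⟨ [] ⟩⊢ φ → 𝓜 ⊨ φ)
    × (BŁ⟨ 𝐃 ∷ [] ⟩⊢ φ → 𝓜 ⊆ Serial → 𝓜 ⊨ φ)
    × (BŁ⟨ 𝟒 ∷ [] ⟩⊢ φ → 𝓜 ⊆ Transitive → 𝓜 ⊨ φ)
    × (BŁ⟨ 𝟓 ∷ [] ⟩⊢ φ → 𝓜 ⊆ Recognizable → 𝓜 ⊨ φ)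
    × (BŁ⟨ 𝐓 ∷ [] ⟩⊢ φ → 𝓜 ⊆ Reflexive → 𝓜 ⊨ φ)
    × (BŁ⟨ x ⟩⊢ φ → (∀ y → y ∈ x → 𝓜 ⊆ Property y) → 𝓜 ⊨ φ)
theorem3p1 ℝ 𝒫 𝒜 𝓜 φ k 1≤k k≤4 x comb =
    -- No symbol belongs to the empty list, so no property is demanded of the class.
    soundness ℝ 𝒫 𝒜 (λ _ ())
  , soundness₁ ℝ 𝒫 𝒜 𝐃
  , soundness₁ ℝ 𝒫 𝒜 𝟒
  , soundness₁ ℝ 𝒫 𝒜 𝟓
  , soundness₁ ℝ 𝒫 𝒜 𝐓
  , λ ⊢φ 𝓜⊆ → soundness ℝ 𝒫 𝒜 𝓜⊆ ⊢φ
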